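{- Let $(G,\sigma)$ be a simple signed graph with a unique Sachs subgraph $S$. Then: (1) $(G,\sigma)$ has an integral inverse if and only if $S$ is a perfect matching; (2) if $(G,\sigma)$ has a simple inverse, then $S$ is a perfect matching.
   Context: A signed graph $(G,\sigma)$ is a graph with $\sigma:E(G)\to\{ -1,+1\}$; its adjacency matrix $\mathbb A$ has $(\mathbb A)_{ij}=\sigma(ij)$ if $ij\in E(G)$ and $0$ otherwise; it is simple if $G$ has no loops or multiple edges. A Sachs subgraph is a spanning subgraph each of whose components is a $K_2$ or a cycle (or a loop). If $\mathbb A$ is invertible, the inverse of $(G,\sigma)$ is the weighted graph with adjacency matrix $\mathbb A^{ -1}$ (edge $ij$ present with weight $(\mathbb A^{ -1})_{ij}$ iff this entry is nonzero, loops corresponding to nonzero diagonal entries). $(G,\sigma)$ has an integral inverse if $\mathbb A$ is invertible and all entries of $\mathbb A^{ -1}$ are integers; it has a simple inverse if $\mathbb A$ is invertible and $\mathbb A^{ -1}$ has all diagonal entries zero (the inverse has no loops). -}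

module Defs where

open import Data.Nat as ℕ using (ℕ)
open import Data.Bool using (Bool; true; false; if_then_else_)
open import Data.Fin using (Fin)
open import Data.List using (List; foldr; map; allFin)
open import Data.Sign using (Sign)
open import Data.Integer as ℤ using (ℤ)
open import Data.Rational as ℚ using (ℚ)
open import Data.Product using (Σ; _×_; ∃)
open import Relation.Binary.PropositionalEquality using (_≡_)
open import Relation.Nullary.Decidable using (⌊_⌋)
open import Data.Sum using (_⊎_)
import Data.Fin as Fin

record SignedGraph (n : ℕ) : Set where
  field
    edge     : Fin n → Fin n → Bool
    sign     : Fin n → Fin n → Sign
    noLoop   : ∀ i → edge i i ≡ false
    edgeSym  : ∀ i j → edge i j ≡ edge j i
    signSym  : ∀ i j → edge i j ≡ true → sign i j ≡ sign j i
open SignedGraph public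

signℤ : Sign → ℤ
signℤ Sign.+ = ℤ.+ 1
signℤ Sign.- = ℤ.- (ℤ.+ 1)

adj : ∀ {n} → SignedGraph n → Fin n → Fin n → ℤ
adj G i j = if edge G i j then signℤ (sign G i j) else ℤ.+ 0

Σℕ : ∀ n → (Fin n → ℕ) → ℕ
Σℕ n f = foldr ℕ._+_ 0 (map f (allFin n))

Σℤ : ∀ n → (Fin n → ℤ) → ℤ
Σℤ n f = foldr ℤ._+_ (ℤ.+ 0) (map f (allFin n))

Σℚ : ∀ n → (Fin n → ℚ) → ℚ
Σℚ n f = foldr ℚ._+_ ℚ.0ℚ (map f (allFin n))

Matℚ : ℕ → Set
Matℚ n = Fin n → Fin n → ℚ

_*ℚ_ : ∀ {n} → Matℚ n → Matℚ n → Matℚ n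
_*ℚ_ {n} A B i j = Σℚ n (λ k → A i k ℚ.* B k j)

Iℚ : ∀ {n} → Matℚ n
Iℚ i j = if ⌊ i Fin.≟ j ⌋ then ℚ.1ℚ else ℚ.0ℚ

adjℚ : ∀ {n} → SignedGraph n → Matℚ n
adjℚ G i j = adj G i j ℚ./ 1

IsInverse : ∀ {n} → SignedGraph n → Matℚ n → Set
IsInverse G B = (∀ i j → (adjℚ G *ℚ B) i j ≡ Iℚ i j) × (∀ i j → (B *ℚ adjℚ G) i j ≡ Iℚ i j)

HasIntegralInverse : ∀ {n} → SignedGraph n → Set
HasIntegralInverse {n} G =
  Σ (Matℚ n) λ B → IsInverse G B × (∀ i j → ∃ λ (z : ℤ) → B i j ≡ z ℚ./ 1)

-- simple inverse: 𝔸 invertible and 𝔸⁻¹ has zero diagonal (no loops)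
HasSimpleInverse : ∀ {n} → SignedGraph n → Set
HasSimpleInverse {n} G =
  Σ (Matℚ n) λ B → IsInverse G B × (∀ i → B i i ≡ ℚ.0ℚ)

-- spanning subgraphs, given by their edge sets
Subgraph : ℕ → Set
Subgraph n = Fin n → Fin n → Bool

deg : ∀ {n} → Subgraph n → Fin n → ℕ
deg {n} H i = Σℕ n (λ j → if H i j then 1 else 0)

data Reach {n} (H : Subgraph n) (v : Fin n) : Fin n → Set where
  here : Reach H v v
  step : ∀ {u w} → Reach H v u → H u w ≡ true → Reach H v w

-- H is a spanning subgraph of G each of whose components is a K₂
-- (connected 1-regular) or a cycle (connected 2-regular).
-- (G is simple, so there are no loop components.)
IsSachs : ∀ {n} → SignedGraph n → Subgraph n → Set
IsSachs G H =
  (∀ i j → H i j ≡ true → edge G i j ≡ true) ×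
  (∀ i j → H i j ≡ H j i) ×
  (∀ v → (∀ u → Reach H v u → deg H u ≡ 1) ⊎ (∀ u → Reach H v u → deg H u ≡ 2))

UniqueSachs : ∀ {n} → SignedGraph n → Subgraph n → Set
UniqueSachs G S = IsSachs G S × (∀ S′ → IsSachs G S′ → ∀ i j → S′ i j ≡ S i j)

IsPerfectMatching : ∀ {n} → Subgraph n → Set
IsPerfectMatching H = ∀ v → deg H v ≡ 1

{-# OPTIONS --safe #-}

-- A permutation π of the vertices along edges has the Sachs subgraph {x, π x} as its support, and a
-- vertex x lies on a K₂ of it iff π (π x) = x. By uniqueness all these supports equal S.
--
-- Let B be the inverse of A. If A v k ≠ 0 and the 2×2 minor of B on {v, k} is nonzero, then A is still
-- nonsingular after deleting v and k, so a nonzero transversal of the rest, together with the swap of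
-- v and k, is a permutation along edges, and v has degree 1 in S. For given v choose k with
-- A v k * B k v nonzero (in part (1): odd; it exists since (A B) v v = 1). In part (2) the minor is,
-- up to sign, (B k v)². In part (1) it is odd, because B v v is a value of the quadratic form of A, hence even.
--
-- Conversely let S be a perfect matching m. A cycle of the relation "j ≠ i and m j is adjacent to i"
-- would give a permutation along edges other than m, so the relation is well-founded, and A is
-- triangular along it with diagonal entries ±1 after the columns are permuted by m.

module Submission where

open import Defs
open import Algebra.Bundles using (CommutativeMonoid; CommutativeRing)
import Algebra.Properties.CommutativeMonoid.Sum as MonoidSum
import Algebra.Properties.Semiring.Sum as SemiringSum
open import Data.Bool as Bool using (Bool; true; false; if_then_else_; _∨_)
open import Data.Bool.Properties using (∨-comm)
open import Data.Fin using (Fin; zero; suc; punchIn; punchOut; toℕ)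
open import Data.Fin.Induction using (spo-wellFounded)
open import Data.Fin.Permutation as Perm
  using (Permutation′; _⟨$⟩ʳ_; _⟨$⟩ˡ_; permutation; insert; insert-punchIn)
open import Data.Fin.Properties
  using (_≟_; ¬∀⟶∃¬; pigeonhole; punchInᵢ≢i; punchIn-injective; punchIn-punchOut)
open import Data.Integer as ℤ using (ℤ)
open import Data.Integer.Divisibility.Signed as Div using (_∣_; _∣?_; divides)
import Data.Integer.Properties as ℤₚ
open import Data.List using (foldr; map; allFin; tabulate)
open import Data.List.Properties using (map-tabulate)
open import Data.Nat as ℕ using (ℕ; zero; suc)
open import Data.Nat.Coprimality as Coprime using (1-coprimeTo)
open import Data.Nat.GeneralisedArithmetic using (fold; fold-+)
open import Data.Nat.Primality using (euclidsLemma; prime[2])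
import Data.Nat.Properties as ℕₚ
open import Data.Product using (_×_; _,_; ∃; proj₁; proj₂)
open import Data.Rational as ℚ using (ℚ; 0ℚ; 1ℚ; mkℚ; _+_; _*_; _-_; -_)
import Data.Rational.Properties as ℚₚ
open import Data.Sign using (Sign)
open import Data.Sum as Sum using (_⊎_; inj₁; inj₂; [_,_]′)
open import Data.Vec.Functional as Vector using (Vector)
open import Function using (_∘_; id; case_of_)
open import Function.Bundles using (_⇔_; mk⇔)
open import Induction.WellFounded using (WellFounded; module FixPoint; module All)
open import Level using (0ℓ)
open import Relation.Binary.Construct.Closure.Transitive as Plus using (TransClosure; [_]; _∷_)
open import Relation.Binary.PropositionalEquality
open import Relation.Nullary using (¬_; Dec; yes; no; contradiction)
open import Relation.Nullary.Decidable using (⌊_⌋; ¬?; _×-dec_; from-no)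

-- Finite sums.

module ℚΣ = SemiringSum (CommutativeRing.semiring ℚₚ.+-*-commutativeRing)
module ℤΣ = SemiringSum (CommutativeRing.semiring ℤₚ.+-*-commutativeRing)
module ℕΣ = SemiringSum ℕₚ.+-*-semiring

-- Turns the list sums of the definitions into sums of functions on `Fin n`, to which the sum lemmas
-- apply.
foldr-allFin : ∀ {a b} {A : Set a} {B : Set b} (_∙_ : A → B → B) (e : B) {n} (f : Fin n → A) →
               foldr _∙_ e (map f (allFin n)) ≡ Vector.foldr _∙_ e f
foldr-allFin _∙_ e f = trans (cong (foldr _∙_ e) (map-tabulate (λ i → i) f)) (go f)
  where
  go : ∀ {n} (f : Fin n → _) → foldr _∙_ e (tabulate f) ≡ Vector.foldr _∙_ e f
  go {zero}  f = refl
  go {suc n} f = cong (f zero ∙_) (go (f ∘ suc))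

module _ {c ℓ} (M : CommutativeMonoid c ℓ) where
  open CommutativeMonoid M using (Carrier; _≈_; _∙_; ε; identityʳ; ∙-congˡ)
  open MonoidSum M
  open import Relation.Binary.Reasoning.Setoid (CommutativeMonoid.setoid M)

  sum-zero : ∀ {n} (t : Vector Carrier n) → (∀ k → t k ≈ ε) → sum t ≈ ε
  sum-zero {n} t t≈ε = begin
    sum t                        ≈⟨ sum-cong-≋ t≈ε ⟩
    sum (Vector.replicate n ε)   ≈⟨ sum-replicate-zero n ⟩
    ε                            ∎

  sum-single : ∀ {n} (t : Vector Carrier n) i → (∀ k → k ≢ i → t k ≈ ε) → sum t ≈ t i
  sum-single {suc n} t i t≈ε = begin
    sum t                               ≈⟨ sum-remove t ⟩
    t i ∙ sum (Vector.removeAt t i)     ≈⟨ ∙-congˡ (sum-zero _ (λ k → t≈ε (punchIn i k) (punchInᵢ≢i i k))) ⟩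
    t i ∙ ε                             ≈⟨ identityʳ (t i) ⟩
    t i                                 ∎

ℚ-sum-zero = sum-zero (CommutativeRing.+-commutativeMonoid ℚₚ.+-*-commutativeRing)
ℚ-sum-single = sum-single (CommutativeRing.+-commutativeMonoid ℚₚ.+-*-commutativeRing)
ℤ-sum-single = sum-single (CommutativeRing.+-commutativeMonoid ℤₚ.+-*-commutativeRing)
ℕ-sum-single = sum-single ℕₚ.+-0-commutativeMonoid

-- Transversals of nonsingular matrices

ℚ-*-≢0 : ∀ {p q} → p ≢ 0ℚ → q ≢ 0ℚ → p * q ≢ 0ℚ
ℚ-*-≢0 {p} {q} p≢0 q≢0 pq≡0 = q≢0 (begin
  q                     ≡⟨ sym (ℚₚ.*-identityˡ q) ⟩
  1ℚ * q                ≡⟨ cong (_* q) (sym (ℚₚ.*-inverseˡ p)) ⟩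
  (ℚ.1/ p) * p * q      ≡⟨ ℚₚ.*-assoc (ℚ.1/ p) p q ⟩
  (ℚ.1/ p) * (p * q)    ≡⟨ cong ((ℚ.1/ p) *_) pq≡0 ⟩
  (ℚ.1/ p) * 0ℚ         ≡⟨ ℚₚ.*-zeroʳ (ℚ.1/ p) ⟩
  0ℚ                    ∎)
  where
  open ≡-Reasoning
  instance _ = ℚ.≢-nonZero p≢0

_·_ : ∀ {l m n} → (Fin l → Fin m → ℚ) → (Fin m → Fin n → ℚ) → Fin l → Fin n → ℚ
(A · B) i j = ℚΣ.sum λ k → A i k * B k j

-- Weaker than being the identity, because each pivot step scales the diagonal by the pivot entry;
-- this form survives the scaling.
NonsingularDiagonal : ∀ {n} → Matℚ n → Set
NonsingularDiagonal D = (∀ i → D i i ≢ 0ℚ) × (∀ i j → i ≢ j → D i j ≡ 0ℚ)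

-- The submatrix without row `i` and column `k`, not its determinant.
minor : ∀ {n} → Fin (suc n) → Fin (suc n) → Matℚ (suc n) → Matℚ n
minor i k A x p = A (punchIn i x) (punchIn k p)

-- The 2×2 minor of `B` on rows `k`, `p` and columns `i`, `x`.
det₂ : ∀ {n} → Matℚ n → Fin n → Fin n → Fin n → Fin n → ℚ
det₂ B k i p x = B k i * B p x - B p i * B k x

-- The Schur complement of the entry B k i, up to the factor B k i.
pivot : ∀ {n} → Fin (suc n) → Fin (suc n) → Matℚ (suc n) → Matℚ n
pivot k i B p x = det₂ B k i (punchIn k p) (punchIn i x)

-- Column `y` of the pivot is a combination of columns `y′` and `i` of `B` whose entry in row `k`
-- vanishes, so deleting column `k` of `A` loses nothing. Column `i` of `A · B` is zero off row `i`,
-- so only the multiple of column `y′` survives.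
minor-pivot : ∀ {n} (A B : Matℚ (suc n)) i k x y → (∀ j → i ≢ j → (A · B) j i ≡ 0ℚ) →
              (minor i k A · pivot k i B) x y ≡ B k i * (A · B) (punchIn i x) (punchIn i y)
minor-pivot A B i k x y ABi≡0 = begin
  ℚΣ.sum (Vector.removeAt t k)                   ≡⟨ sym (ℚₚ.+-identityˡ _) ⟩
  0ℚ + ℚΣ.sum (Vector.removeAt t k)              ≡⟨ cong (_+ ℚΣ.sum (Vector.removeAt t k)) (sym tk≡0) ⟩
  t k + ℚΣ.sum (Vector.removeAt t k)             ≡⟨ sym (ℚΣ.sum-remove {i = k} t) ⟩
  ℚΣ.sum t                                       ≡⟨ ℚΣ.sum-cong-≗ expand ⟩
  ℚΣ.sum (λ p → B k i * (A x′ p * B p y′) + (- B k y′) * (A x′ p * B p i))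
    ≡⟨ ℚΣ.∑-distrib-+ (λ p → B k i * (A x′ p * B p y′)) (λ p → (- B k y′) * (A x′ p * B p i)) ⟩
  ℚΣ.sum (λ p → B k i * (A x′ p * B p y′)) + ℚΣ.sum (λ p → (- B k y′) * (A x′ p * B p i))
    ≡⟨ cong₂ _+_ (sym (ℚΣ.*-distribˡ-sum (B k i) λ p → A x′ p * B p y′))
                  (sym (ℚΣ.*-distribˡ-sum (- B k y′) λ p → A x′ p * B p i)) ⟩
  B k i * (A · B) x′ y′ + (- B k y′) * (A · B) x′ i
    ≡⟨ cong (λ z → B k i * (A · B) x′ y′ + (- B k y′) * z) (ABi≡0 x′ (punchInᵢ≢i i x ∘ sym)) ⟩
  B k i * (A · B) x′ y′ + (- B k y′) * 0ℚ
    ≡⟨ cong (B k i * (A · B) x′ y′ +_) (ℚₚ.*-zeroʳ (- B k y′)) ⟩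
  B k i * (A · B) x′ y′ + 0ℚ                     ≡⟨ ℚₚ.+-identityʳ _ ⟩
  B k i * (A · B) x′ y′                          ∎
  where
  open ≡-Reasoning
  open import Data.Rational.Solver
  open +-*-Solver
  x′ = punchIn i x
  y′ = punchIn i y
  t = λ p → A x′ p * det₂ B k i p y′
  tk≡0 : t k ≡ 0ℚ
  tk≡0 = solve 3 (λ a b c → a :* (b :* c :+ :- (b :* c)) := con 0ℚ) refl (A x′ k) (B k i) (B k y′)
  expand : ∀ p → t p ≡ B k i * (A x′ p * B p y′) + (- B k y′) * (A x′ p * B p i)
  expand p = solve 5 (λ a b c d e → a :* (b :* c :+ :- (d :* e)) := b :* (a :* c) :+ (:- e) :* (a :* d))
    refl (A x′ p) (B k i) (B p y′) (B p i) (B k y′)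

pivot-nonsingular : ∀ {n} (A B : Matℚ (suc n)) i k → NonsingularDiagonal (A · B) → B k i ≢ 0ℚ →
                    NonsingularDiagonal (minor i k A · pivot k i B)
pivot-nonsingular A B i k (AB≢0 , AB≡0) Bki≢0 =
  (λ x → ℚ-*-≢0 Bki≢0 (AB≢0 _) ∘ trans (sym (minor-pivot A B i k x x AB·i≡0))) ,
  (λ x y x≢y → begin
    (minor i k A · pivot k i B) x y              ≡⟨ minor-pivot A B i k x y AB·i≡0 ⟩
    B k i * (A · B) (punchIn i x) (punchIn i y)  ≡⟨ cong (B k i *_) (AB≡0 _ _ (x≢y ∘ punchIn-injective i x y)) ⟩
    B k i * 0ℚ                                   ≡⟨ ℚₚ.*-zeroʳ (B k i) ⟩
    0ℚ                                           ∎)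
  where
  open ≡-Reasoning
  AB·i≡0 : ∀ j → i ≢ j → (A · B) j i ≡ 0ℚ
  AB·i≡0 j i≢j = AB≡0 j i (i≢j ∘ sym)

sum≢0⇒term≢0 : ∀ {n} (t : Vector ℚ n) → ℚΣ.sum t ≢ 0ℚ → ∃ λ k → t k ≢ 0ℚ
sum≢0⇒term≢0 t ∑t≢0 = ¬∀⟶∃¬ _ _ (λ k → t k ℚ.≟ 0ℚ) (∑t≢0 ∘ ℚ-sum-zero t)

forall-punchIn : ∀ {n p} (P : Fin (suc n) → Set p) i → P i → (∀ x → P (punchIn i x)) → ∀ x → P x
forall-punchIn P i Pi Pp x with i ≟ x
... | yes refl = Pi
... | no i≢x = subst P (punchIn-punchOut i≢x) (Pp (punchOut i≢x))

insert-at : ∀ {n} i k (π : Permutation′ n) → insert i k π ⟨$⟩ʳ i ≡ k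
insert-at i k π with i ≟ i
... | yes _ = refl
... | no i≢i = contradiction refl i≢i

Transversal : ∀ {n} → Matℚ n → Permutation′ n → Set
Transversal A π = ∀ x → A x (π ⟨$⟩ʳ x) ≢ 0ℚ

-- Takes the place of the Leibniz formula. A nonzero term `A zero k * B k zero` of the first
-- diagonal entry supplies two things: its first factor is an entry for the transversal, its second
-- is the pivot that keeps the remaining minor nonsingular for the induction.
nonsingular⇒transversal : ∀ {n} (A B : Matℚ n) → NonsingularDiagonal (A · B) → ∃ (Transversal A)
minor-transversal : ∀ {n} (A B : Matℚ (suc n)) i k → NonsingularDiagonal (A · B) → B k i ≢ 0ℚ →
                    ∃ (Transversal (minor i k A))

minor-transversal A B i k D Bki≢0 =
  nonsingular⇒transversal (minor i k A) (pivot k i B) (pivot-nonsingular A B i k D Bki≢0)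

insert-transversal : ∀ {n} (A : Matℚ (suc n)) i k (π : Permutation′ n) → Transversal (minor i k A) π →
                     ∀ x → A (punchIn i x) (insert i k π ⟨$⟩ʳ punchIn i x) ≢ 0ℚ
insert-transversal A i k π tr x =
  subst (λ y → A (punchIn i x) y ≢ 0ℚ) (sym (insert-punchIn i k π x)) (tr x)

nonsingular⇒transversal {zero}  A B D = Perm.id , λ ()
nonsingular⇒transversal {suc n} A B D =
  let k , AB≢0 = sum≢0⇒term≢0 (λ k → A zero k * B k zero) (proj₁ D zero)
      A0k≢0 = λ eq → AB≢0 (trans (cong (_* B k zero) eq) (ℚₚ.*-zeroˡ (B k zero)))
      Bk0≢0 = λ eq → AB≢0 (trans (cong (A zero k *_) eq) (ℚₚ.*-zeroʳ (A zero k)))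
      π , tr = minor-transversal A B zero k D Bk0≢0
  in insert zero k π ,
     forall-punchIn (λ x → A x (insert zero k π ⟨$⟩ʳ x) ≢ 0ℚ) zero
       (subst (λ y → A zero y ≢ 0ℚ) (sym (insert-at zero k π)) A0k≢0)
       (insert-transversal A zero k π tr)

-- Jacobi's identity in disguise: if the minor of B on {v, k} is nonzero, then so is the complementary
-- minor of its inverse A, which therefore has a transversal.
swap-transversal : ∀ {n} (A B : Matℚ n) v k → NonsingularDiagonal (A · B) → v ≢ k →
                   A v k ≢ 0ℚ → A k v ≢ 0ℚ → B k v ≢ 0ℚ → det₂ B k v v k ≢ 0ℚ →
                   ∃ λ π → Transversal A π × π ⟨$⟩ʳ v ≡ k × π ⟨$⟩ʳ k ≡ v
swap-transversal {suc zero} A B zero zero D v≢k = contradiction refl v≢k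
swap-transversal {suc (suc n)} A B v k D v≢k Avk≢0 Akv≢0 Bkv≢0 det≢0 =
  ρ , tr , insert-at v k ρ′ , ρk≡v
  where
  k′ = punchOut v≢k
  v′ = punchOut (v≢k ∘ sym)
  k′-eq : punchIn v k′ ≡ k
  k′-eq = punchIn-punchOut v≢k
  v′-eq : punchIn k v′ ≡ v
  v′-eq = punchIn-punchOut (v≢k ∘ sym)
  A′ = minor v k A
  -- The second pivot is the entry of `pivot k v B` in row `v′` and column `k′`, which is the minor
  -- assumed nonzero.
  inner = minor-transversal A′ (pivot k v B) k′ v′ (pivot-nonsingular A B v k D Bkv≢0)
    (subst₂ (λ p x → det₂ B k v p x ≢ 0ℚ) (sym v′-eq) (sym k′-eq) det≢0)
  ρ′ = insert k′ v′ (proj₁ inner)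
  ρ = insert v k ρ′
  ρk≡v : ρ ⟨$⟩ʳ k ≡ v
  ρk≡v = begin
    ρ ⟨$⟩ʳ k               ≡⟨ cong (ρ ⟨$⟩ʳ_) (sym k′-eq) ⟩
    ρ ⟨$⟩ʳ punchIn v k′    ≡⟨ insert-punchIn v k ρ′ k′ ⟩
    punchIn k (ρ′ ⟨$⟩ʳ k′) ≡⟨ cong (punchIn k) (insert-at k′ v′ (proj₁ inner)) ⟩
    punchIn k v′           ≡⟨ v′-eq ⟩
    v                      ∎
    where open ≡-Reasoning
  tr′ : Transversal A′ ρ′
  tr′ = forall-punchIn (λ x → A′ x (ρ′ ⟨$⟩ʳ x) ≢ 0ℚ) k′
    (subst (λ y → A′ k′ y ≢ 0ℚ) (sym (insert-at k′ v′ (proj₁ inner)))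
      (subst₂ (λ a b → A a b ≢ 0ℚ) (sym k′-eq) (sym v′-eq) Akv≢0))
    (insert-transversal A′ k′ v′ (proj₁ inner) (proj₂ inner))
  tr : Transversal A ρ
  tr = forall-punchIn (λ x → A x (ρ ⟨$⟩ʳ x) ≢ 0ℚ) v
    (subst (λ y → A v y ≢ 0ℚ) (sym (insert-at v k ρ′)) Avk≢0)
    (insert-transversal A v k ρ′ tr′)

-- Edge-respecting permutations and Sachs subgraphs

support : ∀ {n} → Permutation′ n → Subgraph n
support π x y = ⌊ π ⟨$⟩ʳ x ≟ y ⌋ ∨ ⌊ π ⟨$⟩ʳ y ≟ x ⌋

EdgePermutation : ∀ {n} → SignedGraph n → Permutation′ n → Set
EdgePermutation G π = ∀ x → edge G x (π ⟨$⟩ʳ x) ≡ true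

Perm-injective : ∀ {n} (π : Permutation′ n) {x y} → π ⟨$⟩ʳ x ≡ π ⟨$⟩ʳ y → x ≡ y
Perm-injective π eq = trans (sym (Perm.inverseˡ π)) (trans (cong (π ⟨$⟩ˡ_) eq) (Perm.inverseˡ π))

module _ {n} (π : Permutation′ n) where

  private
    p = π ⟨$⟩ʳ_

  support⁻ : ∀ x y → support π x y ≡ true → p x ≡ y ⊎ p y ≡ x
  support⁻ x y eq with p x ≟ y | p y ≟ x
  ... | yes px≡y | _        = inj₁ px≡y
  ... | no _     | yes py≡x = inj₂ py≡x
  support⁻ x y () | no _ | no _

  support-image : ∀ x → support π x (p x) ≡ true
  support-image x with p x ≟ p x
  ... | yes _    = refl
  ... | no px≢px = contradiction refl px≢px

  support-sym : ∀ x y → support π x y ≡ support π y x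
  support-sym x y = ∨-comm ⌊ p x ≟ y ⌋ ⌊ p y ≟ x ⌋

  -- A neighbour of `x` is its image or preimage under `p`, and both inherit `p (p x) ≡ x`. So this
  -- property is constant on components, which yields the constant degree that `IsSachs` asks for.
  step-involutive : ∀ {x y} → support π x y ≡ true → p (p x) ≡ x → p (p y) ≡ y
  step-involutive {x} {y} xy ppx≡x with support⁻ x y xy
  ... | inj₁ refl = cong p ppx≡x
  ... | inj₂ refl = Perm-injective π ppx≡x

  reach-involutive : ∀ {x y} → Reach (support π) x y → p (p x) ≡ x → p (p y) ≡ y
  reach-involutive here       ppx≡x = ppx≡x
  reach-involutive (step r e) ppx≡x = step-involutive e (reach-involutive r ppx≡x)

  reach-involutive⁻ : ∀ {x y} → Reach (support π) x y → p (p y) ≡ y → p (p x) ≡ x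
  reach-involutive⁻ here                       ppy≡y = ppy≡y
  reach-involutive⁻ (step {u = u} {w = w} r e) ppy≡y =
    reach-involutive⁻ r (step-involutive (trans (support-sym w u) e) ppy≡y)

  private
    indicator-or : ∀ {a b} {A : Set a} {B : Set b} (A? : Dec A) (B? : Dec B) → ¬ (A × B) →
                   (if ⌊ A? ⌋ ∨ ⌊ B? ⌋ then 1 else 0) ≡ (if ⌊ A? ⌋ then 1 else 0) ℕ.+ (if ⌊ B? ⌋ then 1 else 0)
    indicator-or (yes a) (yes b) ¬ab = contradiction (a , b) ¬ab
    indicator-or (yes a) (no _)  ¬ab = refl
    indicator-or (no _)  (yes b) ¬ab = refl
    indicator-or (no _)  (no _)  ¬ab = refl

    indicator-yes : ∀ {a} {A : Set a} (A? : Dec A) → A → (if ⌊ A? ⌋ then 1 else 0) ≡ 1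
    indicator-yes (yes _) a = refl
    indicator-yes (no ¬a) a = contradiction a ¬a

    indicator-no : ∀ {a} {A : Set a} (A? : Dec A) → ¬ A → (if ⌊ A? ⌋ then 1 else 0) ≡ 0
    indicator-no (yes a) ¬a = contradiction a ¬a
    indicator-no (no _)  ¬a = refl

  sum-image : ∀ x → ℕΣ.sum (λ y → if ⌊ p x ≟ y ⌋ then 1 else 0) ≡ 1
  sum-image x = trans (ℕ-sum-single _ (p x) λ k k≢px → indicator-no (p x ≟ k) (k≢px ∘ sym))
                      (indicator-yes (p x ≟ p x) refl)

  sum-preimage : ∀ x → ℕΣ.sum (λ y → if ⌊ p y ≟ x ⌋ then 1 else 0) ≡ 1
  sum-preimage x = trans
    (ℕ-sum-single _ (π ⟨$⟩ˡ x) λ k k≢ →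
      indicator-no (p k ≟ x) λ pk≡x → k≢ (Perm-injective π (trans pk≡x (sym (Perm.inverseʳ π)))))
    (indicator-yes (p (π ⟨$⟩ˡ x) ≟ x) (Perm.inverseʳ π))

  deg-support : ∀ x → deg (support π) x ≡ ℕΣ.sum (λ y → if support π x y then 1 else 0)
  deg-support x = foldr-allFin ℕ._+_ 0 (λ y → if support π x y then 1 else 0)

  deg-involutive : ∀ x → p (p x) ≡ x → deg (support π) x ≡ 1
  deg-involutive x ppx≡x = begin
    deg (support π) x                              ≡⟨ deg-support x ⟩
    ℕΣ.sum (λ y → if support π x y then 1 else 0)  ≡⟨ ℕ-sum-single _ (p x) off ⟩
    (if support π x (p x) then 1 else 0)           ≡⟨ cong (λ b → if b then 1 else 0) (support-image x) ⟩
    1                                              ∎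
    where
    open ≡-Reasoning
    off : ∀ k → k ≢ p x → (if support π x k then 1 else 0) ≡ 0
    off k k≢px with support π x k in eq
    ... | false = refl
    ... | true with support⁻ x k eq
    ...   | inj₁ px≡k = contradiction (sym px≡k) k≢px
    ...   | inj₂ pk≡x = contradiction (Perm-injective π (trans pk≡x (sym ppx≡x))) k≢px

  -- Here the two disjuncts of `support` exclude each other, so the degree is the number of images
  -- plus the number of preimages.
  deg-noninvolutive : ∀ x → p (p x) ≢ x → deg (support π) x ≡ 2
  deg-noninvolutive x ppx≢x = begin
    deg (support π) x                              ≡⟨ deg-support x ⟩
    ℕΣ.sum (λ y → if support π x y then 1 else 0)
      ≡⟨ ℕΣ.sum-cong-≗ (λ y → indicator-or (p x ≟ y) (p y ≟ x) λ where (refl , eq) → ppx≢x eq) ⟩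
    ℕΣ.sum (λ y → (if ⌊ p x ≟ y ⌋ then 1 else 0) ℕ.+ (if ⌊ p y ≟ x ⌋ then 1 else 0))
      ≡⟨ ℕΣ.∑-distrib-+ (λ y → if ⌊ p x ≟ y ⌋ then 1 else 0) (λ y → if ⌊ p y ≟ x ⌋ then 1 else 0) ⟩
    ℕΣ.sum (λ y → if ⌊ p x ≟ y ⌋ then 1 else 0) ℕ.+ ℕΣ.sum (λ y → if ⌊ p y ≟ x ⌋ then 1 else 0)
      ≡⟨ cong₂ ℕ._+_ (sum-image x) (sum-preimage x) ⟩
    2                                              ∎
    where open ≡-Reasoning

  support-isSachs : (G : SignedGraph n) → EdgePermutation G π → IsSachs G (support π)
  support-isSachs G πG = sub , support-sym , components
    where
    sub : ∀ i j → support π i j ≡ true → edge G i j ≡ true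
    sub i j ij with support⁻ i j ij
    ... | inj₁ refl = πG i
    ... | inj₂ refl = trans (edgeSym G (p j) j) (πG j)
    components : ∀ v → (∀ u → Reach (support π) v u → deg (support π) u ≡ 1) ⊎
                       (∀ u → Reach (support π) v u → deg (support π) u ≡ 2)
    components v with p (p v) ≟ v
    ... | yes ppv≡v = inj₁ λ u r → deg-involutive u (reach-involutive r ppv≡v)
    ... | no  ppv≢v = inj₂ λ u r → deg-noninvolutive u (ppv≢v ∘ reach-involutive⁻ r)

deg-cong : ∀ {n} {H H′ : Subgraph n} → (∀ i j → H i j ≡ H′ i j) → ∀ v → deg H v ≡ deg H′ v
deg-cong {H = H} {H′} eq v = begin
  deg H v                                   ≡⟨ foldr-allFin ℕ._+_ 0 (λ j → if H v j then 1 else 0) ⟩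
  ℕΣ.sum (λ j → if H v j then 1 else 0)     ≡⟨ ℕΣ.sum-cong-≗ (λ j → cong (λ b → if b then 1 else 0) (eq v j)) ⟩
  ℕΣ.sum (λ j → if H′ v j then 1 else 0)    ≡⟨ sym (foldr-allFin ℕ._+_ 0 (λ j → if H′ v j then 1 else 0)) ⟩
  deg H′ v                                  ∎
  where open ≡-Reasoning

-- The embedding of the integers in the rationals

fromℤ : ℤ → ℚ
fromℤ z = z ℚ./ 1

-- The quotient `z / 1` is normalised by a gcd, which is stuck for a variable `z`; the explicit form
-- lets numerators, sums and products compute.
fromℤ-mkℚ : ∀ z → fromℤ z ≡ mkℚ z 0 (Coprime.sym (1-coprimeTo ℤ.∣ z ∣))
fromℤ-mkℚ z = ℚₚ.↥p/↧p≡p (mkℚ z 0 (Coprime.sym (1-coprimeTo ℤ.∣ z ∣)))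

fromℤ-injective : ∀ {z w} → fromℤ z ≡ fromℤ w → z ≡ w
fromℤ-injective {z} {w} eq = cong ℚ.↥_ (trans (sym (fromℤ-mkℚ z)) (trans eq (fromℤ-mkℚ w)))

fromℤ-+ : ∀ z w → fromℤ (z ℤ.+ w) ≡ fromℤ z + fromℤ w
fromℤ-+ z w = trans
  -- Addition of fractions cross-multiplies the numerators by the denominators, here by 1.
  (cong₂ (λ a b → fromℤ (a ℤ.+ b)) (sym (ℤₚ.*-identityʳ z)) (sym (ℤₚ.*-identityʳ w)))
  (sym (cong₂ _+_ (fromℤ-mkℚ z) (fromℤ-mkℚ w)))

fromℤ-* : ∀ z w → fromℤ (z ℤ.* w) ≡ fromℤ z * fromℤ w
fromℤ-* z w = sym (cong₂ _*_ (fromℤ-mkℚ z) (fromℤ-mkℚ w))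

fromℤ-sum : ∀ {n} (t : Vector ℤ n) → ℚΣ.sum (fromℤ ∘ t) ≡ fromℤ (ℤΣ.sum t)
fromℤ-sum {zero}  t = refl
fromℤ-sum {suc n} t = trans (cong (fromℤ (t zero) +_) (fromℤ-sum (t ∘ suc))) (sym (fromℤ-+ (t zero) _))

fromℤ-sum-* : ∀ {n} (a b : Vector ℤ n) →
              ℚΣ.sum (λ k → fromℤ (a k) * fromℤ (b k)) ≡ fromℤ (ℤΣ.sum λ k → a k ℤ.* b k)
fromℤ-sum-* a b = trans (ℚΣ.sum-cong-≗ λ k → sym (fromℤ-* (a k) (b k))) (fromℤ-sum λ k → a k ℤ.* b k)

-- Right inverses of symmetric matrices

*ℚ≡· : ∀ {n} (A B : Matℚ n) i j → (A *ℚ B) i j ≡ (A · B) i j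
*ℚ≡· A B i j = foldr-allFin _+_ 0ℚ λ k → A i k * B k j

Iℚ-diag : ∀ {n} (i : Fin n) → Iℚ i i ≡ 1ℚ
Iℚ-diag i with i ≟ i
... | yes _  = refl
... | no i≢i = contradiction refl i≢i

Iℚ-off : ∀ {n} {i j : Fin n} → i ≢ j → Iℚ i j ≡ 0ℚ
Iℚ-off {i = i} {j} i≢j with i ≟ j
... | yes i≡j = contradiction i≡j i≢j
... | no _    = refl

RightInverse : ∀ {n} → Matℚ n → Matℚ n → Set
RightInverse A B = ∀ i j → (A · B) i j ≡ Iℚ i j

rightInverse⇒nonsingular : ∀ {n} (A B : Matℚ n) → RightInverse A B → NonsingularDiagonal (A · B)
rightInverse⇒nonsingular A B AB≡I =
  (λ i AB≡0 → ℚₚ.1≢0 (trans (sym (Iℚ-diag i)) (trans (sym (AB≡I i i)) AB≡0))) ,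
  (λ i j i≢j → trans (AB≡I i j) (Iℚ-off i≢j))

SymmetricMat : ∀ {n} → Matℚ n → Set
SymmetricMat A = ∀ i j → A i j ≡ A j i

-- B = (AB)ᵀB = BᵀAᵀB = Bᵀ(AB) = Bᵀ, where the third equality uses the symmetry of A.
rightInverse-symmetric : ∀ {n} {A B : Matℚ n} → SymmetricMat A → RightInverse A B → SymmetricMat B
rightInverse-symmetric {n} {A} {B} A-sym AB≡I i j = begin
  B i j                                                 ≡⟨ sym (ℚₚ.*-identityˡ (B i j)) ⟩
  1ℚ * B i j                                            ≡⟨ cong (_* B i j) (sym (Iℚ-diag i)) ⟩
  Iℚ i i * B i j                                        ≡⟨ sym (ℚ-sum-single _ i λ l l≢i →
                                                             trans (cong (_* B l j) (Iℚ-off l≢i)) (ℚₚ.*-zeroˡ (B l j))) ⟩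
  ℚΣ.sum (λ l → Iℚ l i * B l j)                         ≡⟨ ℚΣ.sum-cong-≗ (λ l → cong (_* B l j) (sym (AB≡I l i))) ⟩
  ℚΣ.sum (λ l → (A · B) l i * B l j)                    ≡⟨ ℚΣ.sum-cong-≗ (λ l → ℚΣ.*-distribʳ-sum (B l j) λ k → A l k * B k i) ⟩
  ℚΣ.sum (λ l → ℚΣ.sum λ k → A l k * B k i * B l j)     ≡⟨ ℚΣ.∑-comm (λ l k → A l k * B k i * B l j) ⟩
  ℚΣ.sum (λ k → ℚΣ.sum λ l → A l k * B k i * B l j)     ≡⟨ ℚΣ.sum-cong-≗ (λ k → ℚΣ.sum-cong-≗ (regroup k)) ⟩
  ℚΣ.sum (λ k → ℚΣ.sum λ l → B k i * (A k l * B l j))   ≡⟨ ℚΣ.sum-cong-≗ (λ k → sym (ℚΣ.*-distribˡ-sum (B k i) λ l → A k l * B l j)) ⟩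
  ℚΣ.sum (λ k → B k i * (A · B) k j)                    ≡⟨ ℚΣ.sum-cong-≗ (λ k → cong (B k i *_) (AB≡I k j)) ⟩
  ℚΣ.sum (λ k → B k i * Iℚ k j)                         ≡⟨ ℚ-sum-single _ j (λ k k≢j →
                                                             trans (cong (B k i *_) (Iℚ-off k≢j)) (ℚₚ.*-zeroʳ (B k i))) ⟩
  B j i * Iℚ j j                                        ≡⟨ cong (B j i *_) (Iℚ-diag j) ⟩
  B j i * 1ℚ                                            ≡⟨ ℚₚ.*-identityʳ (B j i) ⟩
  B j i                                                 ∎
  where
  open ≡-Reasoning
  regroup : ∀ k l → A l k * B k i * B l j ≡ B k i * (A k l * B l j)
  regroup k l = begin
    A l k * B k i * B l j      ≡⟨ cong (λ a → a * B k i * B l j) (A-sym l k) ⟩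
    A k l * B k i * B l j      ≡⟨ cong (_* B l j) (ℚₚ.*-comm (A k l) (B k i)) ⟩
    B k i * A k l * B l j      ≡⟨ ℚₚ.*-assoc (B k i) (A k l) (B l j) ⟩
    B k i * (A k l * B l j)    ∎

-- Entries of the adjacency matrix.

adj-sym : ∀ {n} (G : SignedGraph n) i j → adj G i j ≡ adj G j i
adj-sym G i j with edge G i j in eij | edge G j i in eji
... | true  | true  = cong signℤ (signSym G i j eij)
... | false | false = refl
... | true  | false = case trans (sym eij) (trans (edgeSym G i j) eji) of λ ()
... | false | true  = case trans (sym eij) (trans (edgeSym G i j) eji) of λ ()

adjℚ≢0⇒edge : ∀ {n} (G : SignedGraph n) i j → adjℚ G i j ≢ 0ℚ → edge G i j ≡ true
adjℚ≢0⇒edge G i j A≢0 with edge G i j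
... | true  = refl
... | false = contradiction refl A≢0

nonedge⇒adj≡0 : ∀ {n} (G : SignedGraph n) i j → edge G i j ≢ true → adj G i j ≡ ℤ.+ 0
nonedge⇒adj≡0 G i j ¬ij with edge G i j
... | true  = contradiction refl ¬ij
... | false = refl

adj-loop : ∀ {n} (G : SignedGraph n) i → adj G i i ≡ ℤ.+ 0
adj-loop G i rewrite noLoop G i = refl

-- Parity

Even : ℤ → Set
Even z = ℤ.+ 2 ∣ z

even-sum : ∀ {n} (t : Vector ℤ n) → (∀ k → Even (t k)) → Even (ℤΣ.sum t)
even-sum {zero}  t even = divides (ℤ.+ 0) refl
even-sum {suc n} t even = Div.∣m∣n⇒∣m+n (even zero) (even-sum (t ∘ suc) (even ∘ suc))

odd-sum⇒odd-term : ∀ {n} (t : Vector ℤ n) → ¬ Even (ℤΣ.sum t) → ∃ λ k → ¬ Even (t k)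
odd-sum⇒odd-term t odd = ¬∀⟶∃¬ _ _ (λ k → ℤ.+ 2 ∣? t k) (odd ∘ even-sum t)

even-* : ∀ a b → Even (a ℤ.* b) → Even a ⊎ Even b
even-* a b even =
  Sum.map Div.∣ᵤ⇒∣ Div.∣ᵤ⇒∣
    (euclidsLemma ℤ.∣ a ∣ ℤ.∣ b ∣ prime[2] (subst (2 ℕ.∣_) (ℤₚ.abs-* a b) (Div.∣⇒∣ᵤ even)))
  where import Data.Nat.Divisibility as ℕ

-- The entries off the diagonal pair up. Peeling off the first row and the first column gives the
-- same sum `r` twice, and induction handles the rest.
even-symmetric-sum : ∀ {n} (t : Fin n → Fin n → ℤ) → (∀ i j → t i j ≡ t j i) → (∀ i → t i i ≡ ℤ.+ 0) →
                     Even (ℤΣ.sum λ i → ℤΣ.sum (t i))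
even-symmetric-sum {zero}  t t-sym t-diag = divides (ℤ.+ 0) refl
even-symmetric-sum {suc n} t t-sym t-diag =
  subst Even (sym split) (Div.∣m∣n⇒∣m+n (divides r refl)
    (even-symmetric-sum (λ i j → t (suc i) (suc j)) (λ i j → t-sym (suc i) (suc j)) (t-diag ∘ suc)))
  where
  open ≡-Reasoning
  r = ℤΣ.sum λ j → t zero (suc j)
  q = ℤΣ.sum λ i → ℤΣ.sum λ j → t (suc i) (suc j)
  split : ℤΣ.sum (λ i → ℤΣ.sum (t i)) ≡ r ℤ.* ℤ.+ 2 ℤ.+ q
  split = begin
    (t zero zero ℤ.+ r) ℤ.+ ℤΣ.sum (λ i → t (suc i) zero ℤ.+ ℤΣ.sum λ j → t (suc i) (suc j))
      ≡⟨ cong₂ ℤ._+_ (cong (ℤ._+ r) (t-diag zero))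
           (ℤΣ.∑-distrib-+ (λ i → t (suc i) zero) λ i → ℤΣ.sum λ j → t (suc i) (suc j)) ⟩
    (ℤ.+ 0 ℤ.+ r) ℤ.+ (ℤΣ.sum (λ i → t (suc i) zero) ℤ.+ q)
      ≡⟨ cong (λ s → (ℤ.+ 0 ℤ.+ r) ℤ.+ (s ℤ.+ q)) (ℤΣ.sum-cong-≗ λ i → t-sym (suc i) zero) ⟩
    (ℤ.+ 0 ℤ.+ r) ℤ.+ (r ℤ.+ q)
      ≡⟨ solve 2 (λ r q → (con (ℤ.+ 0) :+ r) :+ (r :+ q) := r :* con (ℤ.+ 2) :+ q) refl r q ⟩
    r ℤ.* ℤ.+ 2 ℤ.+ q ∎
    where
    open import Data.Integer.Solver
    open +-*-Solver

-- Necessity of a perfect matching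

module _ {n} (G : SignedGraph n) (S : Subgraph n) (S-unique : UniqueSachs G S) where

  edgePermutation-support : ∀ π → EdgePermutation G π → ∀ i j → support π i j ≡ S i j
  edgePermutation-support π πG = proj₂ S-unique (support π) (support-isSachs π G πG)

  -- The transversal that swaps `v` and `k` is an edge permutation, so its support is `S`, and there
  -- `v` lies on a K₂.
  inverse-det₂⇒deg≡1 : ∀ {B} v k → RightInverse (adjℚ G) B → edge G v k ≡ true → B k v ≢ 0ℚ →
                       det₂ B k v v k ≢ 0ℚ → deg S v ≡ 1
  inverse-det₂⇒deg≡1 {B} v k AB≡I vk Bkv≢0 det≢0 =
    let π , tr , πv≡k , πk≡v = swap-transversal (adjℚ G) B v k (rightInverse⇒nonsingular (adjℚ G) B AB≡I)
                                 v≢k (edge⇒adjℚ≢0 v k vk) (edge⇒adjℚ≢0 k v (trans (edgeSym G k v) vk)) Bkv≢0 det≢0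
    in trans (deg-cong (λ i j → sym (edgePermutation-support π (λ x → adjℚ≢0⇒edge G x _ (tr x)) i j)) v)
             (deg-involutive π v (trans (cong (π ⟨$⟩ʳ_) πv≡k) πk≡v))
    where
    v≢k : v ≢ k
    v≢k refl = case trans (sym vk) (noLoop G v) of λ ()
    edge⇒adjℚ≢0 : ∀ x y → edge G x y ≡ true → adjℚ G x y ≢ 0ℚ
    edge⇒adjℚ≢0 x y xy A≡0 rewrite xy with sign G x y
    ... | Sign.+ = case A≡0 of λ ()
    ... | Sign.- = case A≡0 of λ ()

  inverse-rightInverse : ∀ {B} → IsInverse G B → RightInverse (adjℚ G) B
  inverse-rightInverse {B} (AB≡I , _) i j = trans (sym (*ℚ≡· (adjℚ G) B i j)) (AB≡I i j)

  inverse-symmetric : ∀ {B} → RightInverse (adjℚ G) B → SymmetricMat B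
  inverse-symmetric = rightInverse-symmetric λ i j → cong fromℤ (adj-sym G i j)

  simpleInverse⇒perfectMatching : HasSimpleInverse G → IsPerfectMatching S
  simpleInverse⇒perfectMatching (B , B-inverse , B-diag) v =
    inverse-det₂⇒deg≡1 v k AB≡I (adjℚ≢0⇒edge G v k Avk≢0) Bkv≢0 (ℚ-*-≢0 Bkv≢0 Bvk≢0 ∘ trans (sym det≡))
    where
    open ≡-Reasoning
    AB≡I = inverse-rightInverse B-inverse
    term = sum≢0⇒term≢0 (λ k → adjℚ G v k * B k v) (proj₁ (rightInverse⇒nonsingular (adjℚ G) B AB≡I) v)
    k = proj₁ term
    Avk≢0 : adjℚ G v k ≢ 0ℚ
    Avk≢0 eq = proj₂ term (trans (cong (_* B k v) eq) (ℚₚ.*-zeroˡ (B k v)))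
    Bkv≢0 : B k v ≢ 0ℚ
    Bkv≢0 eq = proj₂ term (trans (cong (adjℚ G v k *_) eq) (ℚₚ.*-zeroʳ (adjℚ G v k)))
    Bvk≢0 : B v k ≢ 0ℚ
    Bvk≢0 = Bkv≢0 ∘ trans (inverse-symmetric AB≡I k v)
    det≡ : det₂ B k v v k ≡ B k v * B v k
    det≡ = begin
      B k v * B v k - B v v * B k k  ≡⟨ cong (λ b → B k v * B v k - b * B k k) (B-diag v) ⟩
      B k v * B v k - 0ℚ * B k k     ≡⟨ cong (λ b → B k v * B v k - b) (ℚₚ.*-zeroˡ (B k k)) ⟩
      B k v * B v k - 0ℚ             ≡⟨ ℚₚ.+-identityʳ (B k v * B v k) ⟩
      B k v * B v k                  ∎

  integralInverse⇒perfectMatching : HasIntegralInverse G → IsPerfectMatching S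
  integralInverse⇒perfectMatching (B , B-inverse , B-integral) v =
    inverse-det₂⇒deg≡1 v k AB≡I vk Bkv≢0 det≢0
    where
    open ≡-Reasoning
    AB≡I = inverse-rightInverse B-inverse
    z : Fin n → Fin n → ℤ
    z i j = proj₁ (B-integral i j)
    B≡z : ∀ i j → B i j ≡ fromℤ (z i j)
    B≡z i j = proj₂ (B-integral i j)
    Az : Fin n → Fin n → ℤ
    Az i j = ℤΣ.sum λ k → adj G i k ℤ.* z k j
    Az≡I : ∀ i j → fromℤ (Az i j) ≡ Iℚ i j
    Az≡I i j = begin
      fromℤ (Az i j)                                       ≡⟨ sym (fromℤ-sum-* (adj G i) (λ k → z k j)) ⟩
      ℚΣ.sum (λ k → adjℚ G i k * fromℤ (z k j))            ≡⟨ ℚΣ.sum-cong-≗ (λ k → cong (adjℚ G i k *_) (sym (B≡z k j))) ⟩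
      (adjℚ G · B) i j                                     ≡⟨ AB≡I i j ⟩
      Iℚ i j                                               ∎
    Az-diag : ∀ i → Az i i ≡ ℤ.+ 1
    Az-diag i = fromℤ-injective (trans (Az≡I i i) (Iℚ-diag i))
    Az-off : ∀ {i j} → i ≢ j → Az i j ≡ ℤ.+ 0
    Az-off {i} {j} i≢j = fromℤ-injective (trans (Az≡I i j) (Iℚ-off i≢j))
    z-sym : ∀ i j → z i j ≡ z j i
    z-sym i j = fromℤ-injective (trans (sym (B≡z i j)) (trans (inverse-symmetric AB≡I i j) (B≡z j i)))

    -- z u u is the value of the quadratic form of A at the u-th column of z.
    form : Fin n → Fin n → Fin n → ℤ
    form u i j = adj G i j ℤ.* z j u ℤ.* z i u
    form-sym : ∀ u i j → form u i j ≡ form u j i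
    form-sym u i j = begin
      adj G i j ℤ.* z j u ℤ.* z i u    ≡⟨ ℤₚ.*-assoc (adj G i j) (z j u) (z i u) ⟩
      adj G i j ℤ.* (z j u ℤ.* z i u)  ≡⟨ cong₂ ℤ._*_ (adj-sym G i j) (ℤₚ.*-comm (z j u) (z i u)) ⟩
      adj G j i ℤ.* (z i u ℤ.* z j u)  ≡⟨ sym (ℤₚ.*-assoc (adj G j i) (z i u) (z j u)) ⟩
      adj G j i ℤ.* z i u ℤ.* z j u    ∎
    form-diag : ∀ u i → form u i i ≡ ℤ.+ 0
    form-diag u i = cong (λ a → a ℤ.* z i u ℤ.* z i u) (adj-loop G i)
    sum-form : ∀ u → ℤΣ.sum (λ i → ℤΣ.sum (form u i)) ≡ z u u
    sum-form u = begin
      ℤΣ.sum (λ i → ℤΣ.sum (form u i))   ≡⟨ ℤΣ.sum-cong-≗ (λ i → sym (ℤΣ.*-distribʳ-sum (z i u) λ j → adj G i j ℤ.* z j u)) ⟩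
      -- The inner sum is an entry of the identity matrix, so only the row `u` remains.
      ℤΣ.sum (λ i → Az i u ℤ.* z i u)    ≡⟨ ℤ-sum-single _ u (λ i i≢u → cong (ℤ._* z i u) (Az-off i≢u)) ⟩
      Az u u ℤ.* z u u                   ≡⟨ cong (ℤ._* z u u) (Az-diag u) ⟩
      ℤ.+ 1 ℤ.* z u u                    ≡⟨ ℤₚ.*-identityˡ (z u u) ⟩
      z u u                              ∎
    z-diag-even : ∀ u → Even (z u u)
    z-diag-even u = subst Even (sum-form u) (even-symmetric-sum (form u) (form-sym u) (form-diag u))

    1-odd : ¬ Even (ℤ.+ 1)
    1-odd = from-no (ℤ.+ 2 ∣? ℤ.+ 1)
    term = odd-sum⇒odd-term (λ k → adj G v k ℤ.* z k v) (1-odd ∘ subst Even (Az-diag v))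
    k = proj₁ term
    zkv-odd : ¬ Even (z k v)
    zkv-odd even = proj₂ term (Div.∣n⇒∣m*n (adj G v k) even)
    vk : edge G v k ≡ true
    vk = adjℚ≢0⇒edge G v k λ A≡0 →
      proj₂ term (subst Even (sym (cong (ℤ._* z k v) (fromℤ-injective {adj G v k} {ℤ.+ 0} A≡0))) (divides (ℤ.+ 0) refl))
    Bkv≢0 : B k v ≢ 0ℚ
    Bkv≢0 B≡0 = zkv-odd (subst Even (sym (fromℤ-injective {w = ℤ.+ 0} (trans (sym (B≡z k v)) B≡0))) (divides (ℤ.+ 0) refl))
    product≡ : det₂ B k v v k ≡ 0ℚ → z k v ℤ.* z k v ≡ z v v ℤ.* z k k
    product≡ det≡0 = fromℤ-injective (begin
      fromℤ (z k v ℤ.* z k v)      ≡⟨ cong (λ w → fromℤ (z k v ℤ.* w)) (z-sym k v) ⟩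
      fromℤ (z k v ℤ.* z v k)      ≡⟨ fromℤ-* (z k v) (z v k) ⟩
      fromℤ (z k v) * fromℤ (z v k)  ≡⟨ sym (cong₂ _*_ (B≡z k v) (B≡z v k)) ⟩
      B k v * B v k                ≡⟨ ℚ-Group.x∙y⁻¹≈ε⇒x≈y _ _ det≡0 ⟩
      B v v * B k k                ≡⟨ cong₂ _*_ (B≡z v v) (B≡z k k) ⟩
      fromℤ (z v v) * fromℤ (z k k)  ≡⟨ sym (fromℤ-* (z v v) (z k k)) ⟩
      fromℤ (z v v ℤ.* z k k)      ∎)
      where import Algebra.Properties.Group ℚₚ.+-0-group as ℚ-Group
    det≢0 : det₂ B k v v k ≢ 0ℚ
    det≢0 det≡0 = [ zkv-odd , zkv-odd ]′
      (even-* (z k v) (z k v) (subst Even (sym (product≡ det≡0)) (Div.∣m⇒∣m*n (z k k) (z-diag-even v))))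

-- Cycles of a relation on a finite set

-- Fixed points are allowed so that a map following a cycle can be total, resting off the cycle.
Moves : ∀ {n} → (Fin n → Fin n → Set) → (Fin n → Fin n) → Set
Moves _∼_ f = ∀ u → f u ≡ u ⊎ u ∼ f u

module _ {n} (_⋖_ : Fin n → Fin n → Set) (⋖-irrefl : ∀ {x} → ¬ x ⋖ x) where

  private
    update : Fin n → Fin n → (Fin n → Fin n) → Fin n → Fin n
    update x y f u with u ≟ x
    ... | yes _ = y
    ... | no _  = f u

    update-at : ∀ x y f → update x y f x ≡ y
    update-at x y f with x ≟ x
    ... | yes _  = refl
    ... | no x≢x = contradiction refl x≢x

    update-moves : ∀ {x y f} → x ⋖ y → Moves _⋖_ f → Moves _⋖_ (update x y f)
    update-moves {x} xy f-moves u with u ≟ x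
    ... | yes refl = inj₂ xy
    ... | no _     = f-moves u

  ⋖⇒≢ : ∀ {x y} → x ⋖ y → y ≢ x
  ⋖⇒≢ xy refl = ⋖-irrefl xy

  -- f leaves each vertex of the walk along the step of the walk after the first visit.
  walk⇒moves : ∀ {x y} → TransClosure _⋖_ x y →
               ∃ λ f → Moves _⋖_ f × f x ≢ x × (∀ u → f u ≢ u → f (f u) ≢ f u ⊎ f u ≡ y)
  walk⇒moves {x} {y} [ xy ] = f , update-moves xy (λ u → inj₁ refl) , fx≢x , closed
    where
    f = update x y (λ u → u)
    fx≢x : f x ≢ x
    fx≢x = ⋖⇒≢ xy ∘ trans (sym (update-at x y (λ u → u)))
    closed : ∀ u → f u ≢ u → f (f u) ≢ f u ⊎ f u ≡ y
    closed u fu≢u with u ≟ x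
    ... | yes refl = inj₂ refl
    ... | no u≢x   = contradiction refl fu≢u
  walk⇒moves {x} {y} (_∷_ {y = x′} xx′ w) with walk⇒moves w
  ... | g , g-moves , gx′≢x′ , g-closed = f , update-moves xx′ g-moves , fx≢x , closed
    where
    f = update x x′ g
    fx≢x : f x ≢ x
    fx≢x = ⋖⇒≢ xx′ ∘ trans (sym (update-at x x′ g))
    -- Overriding `g` at `x` sends `x` to `x′`, which differs from `x`, so no moving point becomes
    -- fixed.
    g-moving⇒f-moving : ∀ u → g u ≢ u → f u ≢ u
    g-moving⇒f-moving u gu≢u with u ≟ x
    ... | yes refl = ⋖⇒≢ xx′
    ... | no _     = gu≢u
    closed : ∀ u → f u ≢ u → f (f u) ≢ f u ⊎ f u ≡ y
    closed u fu≢u with u ≟ x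
    ... | yes refl = inj₁ (g-moving⇒f-moving x′ gx′≢x′)
    ... | no _     = Sum.map₁ (g-moving⇒f-moving (g u)) (g-closed u fu≢u)

  private
    fold-suc : ∀ (f : Fin n → Fin n) k x → fold (f x) f k ≡ f (fold x f k)
    fold-suc f zero    x = refl
    fold-suc f (suc k) x = cong f (fold-suc f k x)

  -- f permutes the points of period suc k, and there its inverse is its k-th iterate.
  module Rotation (f : Fin n → Fin n) (k : ℕ) where

    Periodic : Fin n → Set
    Periodic u = fold u f (suc k) ≡ u

    private
      to from : Fin n → Fin n
      to u with fold u f (suc k) ≟ u
      ... | yes _ = f u
      ... | no _  = u
      from u with fold u f (suc k) ≟ u
      ... | yes _ = fold u f k
      ... | no _  = u

      to-periodic : ∀ u → Periodic u → to u ≡ f u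
      to-periodic u per with fold u f (suc k) ≟ u
      ... | yes _   = refl
      ... | no ¬per = contradiction per ¬per

      from-periodic : ∀ u → Periodic u → from u ≡ fold u f k
      from-periodic u per with fold u f (suc k) ≟ u
      ... | yes _   = refl
      ... | no ¬per = contradiction per ¬per

      to-aperiodic : ∀ u → ¬ Periodic u → to u ≡ u
      to-aperiodic u ¬per with fold u f (suc k) ≟ u
      ... | yes per = contradiction per ¬per
      ... | no _    = refl

      from-aperiodic : ∀ u → ¬ Periodic u → from u ≡ u
      from-aperiodic u ¬per with fold u f (suc k) ≟ u
      ... | yes per = contradiction per ¬per
      ... | no _    = refl

      periodic-f : ∀ u → Periodic u → Periodic (f u)
      periodic-f u per = cong f (trans (fold-suc f k u) per)

      periodic-fold : ∀ u → Periodic u → Periodic (fold u f k)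
      periodic-fold u per = trans (sym (fold-suc f k (fold u f k))) (cong (λ w → fold w f k) per)

      to∘from : ∀ u → to (from u) ≡ u
      to∘from u = case fold u f (suc k) ≟ u of λ where
        (yes per) → trans (cong to (from-periodic u per))
                          (trans (to-periodic (fold u f k) (periodic-fold u per)) per)
        (no ¬per) → trans (cong to (from-aperiodic u ¬per)) (to-aperiodic u ¬per)

      from∘to : ∀ u → from (to u) ≡ u
      from∘to u = case fold u f (suc k) ≟ u of λ where
        (yes per) → trans (cong from (to-periodic u per))
                          (trans (from-periodic (f u) (periodic-f u per)) (trans (fold-suc f k u) per))
        (no ¬per) → trans (cong from (to-aperiodic u ¬per)) (from-aperiodic u ¬per)

    rotation : Permutation′ n
    rotation = permutation to from to∘from from∘to

    rotation-periodic : ∀ u → Periodic u → rotation ⟨$⟩ʳ u ≡ f u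
    rotation-periodic = to-periodic

    rotation-moves : Moves _⋖_ f → Moves _⋖_ (rotation ⟨$⟩ʳ_)
    rotation-moves f-moves u with fold u f (suc k) ≟ u
    ... | yes _ = f-moves u
    ... | no _  = inj₁ refl

  private
    -- For a closed walk the exceptional endpoint is the start `x`, which moves as well, so the
    -- orbit of `x` never comes to rest.
    iterate-moving : ∀ {f : Fin n → Fin n} {x} → f x ≢ x → (∀ u → f u ≢ u → f (f u) ≢ f u ⊎ f u ≡ x) →
                     ∀ k → f (fold x f k) ≢ fold x f k
    iterate-moving fx≢x closed zero    = fx≢x
    iterate-moving {f} {x} fx≢x closed (suc k) =
      [ id , (λ eq → subst (λ u → f u ≢ u) (sym eq) fx≢x) ]′
        (closed (fold x f k) (iterate-moving fx≢x closed k))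

  -- The closed walk may revisit vertices. By the pigeonhole principle the orbit of `x` under `f`
  -- reaches a periodic point `z`; rotating all points of that period gives a permutation, and it
  -- moves `z`.
  cycle⇒permutation : ∀ {x} → TransClosure _⋖_ x x →
                      ∃ λ τ → Moves _⋖_ (τ ⟨$⟩ʳ_) × ∃ λ z → τ ⟨$⟩ʳ z ≢ z
  cycle⇒permutation {x} w =
    let f , f-moves , fx≢x , closed = walk⇒moves w
        moving = iterate-moving fx≢x closed
        i , j , i<j , fⁱ≡fʲ = pigeonhole (ℕₚ.n<1+n n) (λ i → fold x f (toℕ i))
        -- Since `i<j` means `suc i ≤ j`, the offset `k` makes `suc k` the positive distance from
        -- `i` to `j`.
        k , i+k≡j = ℕₚ.m≤n⇒∃[o]m+o≡n i<j
        z = fold x f (toℕ i)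
        periodic : fold z f (suc k) ≡ z
        periodic = trans (sym (fold-+ x f (suc k)))
                     (trans (cong (fold x f) (trans (cong suc (ℕₚ.+-comm k (toℕ i))) i+k≡j)) (sym fⁱ≡fʲ))
        open Rotation f k
    in rotation , rotation-moves f-moves , z , moving (toℕ i) ∘ trans (sym (rotation-periodic z periodic))

  -- Without cycles the transitive closure is a strict partial order on a finite set, hence
  -- well-founded, and the relation inherits this.
  rigid⇒wellFounded : (∀ τ → Moves _⋖_ (τ ⟨$⟩ʳ_) → ∀ z → τ ⟨$⟩ʳ z ≡ z) → WellFounded _⋖_
  rigid⇒wellFounded rigid = Plus.wellFounded⁻ _⋖_ (spo-wellFounded record
    { isEquivalence = isEquivalence
    ; irrefl        = λ where
        refl w → let τ , τ-moves , z , τz≢z = cycle⇒permutation w in τz≢z (rigid τ τ-moves z)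
    ; trans         = Plus.transitive _⋖_
    ; <-resp-≈      = resp₂ (TransClosure _⋖_)
    })

-- Sufficiency of a perfect matching

count : ∀ {n} → Vector Bool n → ℕ
count b = ℕΣ.sum λ j → if b j then 1 else 0

count≡0⇒false : ∀ {n} (b : Vector Bool n) → count b ≡ 0 → ∀ j → b j ≢ true
count≡0⇒false b eq zero    bj rewrite bj = case eq of λ ()
count≡0⇒false b eq (suc j) bj = count≡0⇒false (b ∘ suc) (ℕₚ.m+n≡0⇒n≡0 (if b zero then 1 else 0) eq) j bj

count≡1⇒unique : ∀ {n} (b : Vector Bool n) → count b ≡ 1 → ∃ λ j → b j ≡ true × (∀ k → b k ≡ true → k ≡ j)
count≡1⇒unique {suc n} b eq with b zero in b0
... | true  = zero , b0 , λ where
  zero    bk → refl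
  (suc k) bk → contradiction bk (count≡0⇒false (b ∘ suc) (ℕₚ.suc-injective eq) k)
... | false with count≡1⇒unique (b ∘ suc) eq
...   | j , bj , j-unique = suc j , bj , λ where
  zero    bk → case trans (sym b0) bk of λ ()
  (suc k) bk → cong suc (j-unique k bk)

1*[b-r]+r≡b : ∀ b r → ℤ.+ 1 ℤ.* (b ℤ.- r) ℤ.+ r ≡ b
1*[b-r]+r≡b = solve 2 (λ b r → con (ℤ.+ 1) :* (b :- r) :+ r := b) refl
  where
  open import Data.Integer.Solver
  open +-*-Solver

signℤ-square : ∀ s → signℤ s ℤ.* signℤ s ≡ ℤ.+ 1
signℤ-square Sign.+ = refl
signℤ-square Sign.- = refl

adj-square : ∀ {n} (G : SignedGraph n) i j → edge G i j ≡ true → adj G i j ℤ.* adj G i j ≡ ℤ.+ 1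
adj-square G i j ij rewrite ij = signℤ-square (sign G i j)

module _ {n} (G : SignedGraph n) (S : Subgraph n) (S-unique : UniqueSachs G S) (S-matching : IsPerfectMatching S) where

  private
    partner : ∀ v → ∃ λ j → S v j ≡ true × (∀ k → S v k ≡ true → k ≡ j)
    partner v = count≡1⇒unique (S v) (trans (sym (foldr-allFin ℕ._+_ 0 λ j → if S v j then 1 else 0)) (S-matching v))

    m : Fin n → Fin n
    m v = proj₁ (partner v)

    m-unique : ∀ {v k} → S v k ≡ true → k ≡ m v
    m-unique {v} {k} = proj₂ (proj₂ (partner v)) k

    m-involutive : ∀ v → m (m v) ≡ v
    m-involutive v =
      sym (m-unique (trans (proj₁ (proj₂ (proj₁ S-unique)) (m v) v) (proj₁ (proj₂ (partner v)))))

    m-edge : ∀ v → edge G v (m v) ≡ true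
    m-edge v = proj₁ (proj₁ S-unique) v (m v) (proj₁ (proj₂ (partner v)))

    -- The edge from `v` to its image lies in the support, which is `S`, and there `v` has the
    -- single neighbour `m v`.
    edgePermutation≡m : ∀ π → EdgePermutation G π → ∀ v → π ⟨$⟩ʳ v ≡ m v
    edgePermutation≡m π πG v =
      m-unique (trans (sym (edgePermutation-support G S S-unique π πG v (π ⟨$⟩ʳ v))) (support-image π v))

    -- Says that row `i` of the adjacency matrix has a nonzero entry in column `m j`, other than the
    -- matched column `m i`; so the unknown of `j` enters the equation of `i`.
    _⋖_ : Fin n → Fin n → Set
    j ⋖ i = j ≢ i × edge G (m j) i ≡ true

    _⋖?_ : ∀ j i → Dec (j ⋖ i)
    j ⋖? i = ¬? (j ≟ i) ×-dec (edge G (m j) i Bool.≟ true)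

    ⋖-irrefl : ∀ {x} → ¬ x ⋖ x
    ⋖-irrefl (x≢x , _) = x≢x refl

    m-permutation : Permutation′ n
    m-permutation = permutation m m m-involutive m-involutive

    -- Applying `m` and then `τ` moves each `x` along an edge: a matching edge if `τ` fixes `m x`,
    -- and an edge given by the relation otherwise. By uniqueness the composite is `m`, which leaves
    -- the identity for `τ`.
    ⋖-rigid : ∀ τ → Moves _⋖_ (τ ⟨$⟩ʳ_) → ∀ z → τ ⟨$⟩ʳ z ≡ z
    ⋖-rigid τ τ-moves z = begin
      τ ⟨$⟩ʳ z          ≡⟨ cong (τ ⟨$⟩ʳ_) (sym (m-involutive z)) ⟩
      τ ⟨$⟩ʳ m (m z)    ≡⟨ edgePermutation≡m (m-permutation Perm.∘ₚ τ) τm-edge (m z) ⟩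
      m (m z)           ≡⟨ m-involutive z ⟩
      z                 ∎
      where
      open ≡-Reasoning
      τm-edge : ∀ x → edge G x (τ ⟨$⟩ʳ m x) ≡ true
      τm-edge x with τ-moves (m x)
      ... | inj₁ τmx≡mx   = subst (λ y → edge G x y ≡ true) (sym τmx≡mx) (m-edge x)
      ... | inj₂ (_ , e)  = subst (λ y → edge G y (τ ⟨$⟩ʳ m x) ≡ true) (m-involutive x) e

    abstract
      ⋖-wellFounded : WellFounded _⋖_
      ⋖-wellFounded = rigid⇒wellFounded _⋖_ ⋖-irrefl ⋖-rigid

    -- Up to the permutation m of the columns, the adjacency matrix is triangular along _⋖_ with
    -- diagonal entries ±1, so its equations are solved over ℤ by forward substitution.
    module Solve (b : Vector ℤ n) where

      -- The unknowns are available only below `i`, so the decision is an argument and its proof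
      -- gives access to `y`.
      term : ∀ i → (∀ {j} → j ⋖ i → ℤ) → (k : Fin n) → Dec (m k ⋖ i) → ℤ
      term i y k (yes mk⋖i) = adj G i k ℤ.* y mk⋖i
      term i y k (no _)     = ℤ.+ 0

      -- The diagonal coefficient `adj G i (m i)` is ±1, its own inverse, so multiplying by it
      -- replaces division and stays in ℤ.
      solveRow : ∀ i → (∀ {j} → j ⋖ i → ℤ) → ℤ
      solveRow i y = adj G i (m i) ℤ.* (b i ℤ.- ℤΣ.sum λ k → term i y k (m k ⋖? i))

      term-cong : ∀ i {y y′ : ∀ {j} → j ⋖ i → ℤ} → (∀ {j} (j⋖i : j ⋖ i) → y j⋖i ≡ y′ j⋖i) →
                  ∀ k mk⋖?i → term i y k mk⋖?i ≡ term i y′ k mk⋖?i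
      term-cong i y≡y′ k (yes mk⋖i) = cong (adj G i k ℤ.*_) (y≡y′ mk⋖i)
      term-cong i y≡y′ k (no _)     = refl

      module Fix = FixPoint ⋖-wellFounded (λ _ → ℤ) solveRow
        (λ i {y} {y′} y≡y′ → cong (λ s → adj G i (m i) ℤ.* (b i ℤ.- s))
          (ℤΣ.sum-cong-≗ λ k → term-cong i {y} {y′} y≡y′ k (m k ⋖? i)))
      module Rec = All ⋖-wellFounded 0ℓ

      y : Fin n → ℤ
      y = Rec.wfRec (λ _ → ℤ) solveRow

      -- The values `y` are indexed by rows, and column `k` is matched to row `m k`.
      solution : Fin n → ℤ
      solution k = y (m k)

      rest : ∀ i → Fin n → ℤ
      rest i k = term i (λ {j} _ → y j) k (m k ⋖? i)

      diag : ∀ i (k : Fin n) → Dec (k ≡ m i) → ℤ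
      diag i k (yes _) = adj G i (m i) ℤ.* y i
      diag i k (no _)  = ℤ.+ 0

      split : ∀ i k k≟mi mk⋖?i → adj G i k ℤ.* y (m k) ≡ diag i k k≟mi ℤ.+ term i (λ {j} _ → y j) k mk⋖?i
      split i k (yes refl) (yes (mmi≢i , _)) = contradiction (m-involutive i) mmi≢i
      split i k (yes refl) (no _) =
        trans (cong (λ j → adj G i (m i) ℤ.* y j) (m-involutive i)) (sym (ℤₚ.+-identityʳ _))
      split i k (no _)     (yes _)    = sym (ℤₚ.+-identityˡ _)
      -- A column that is neither matched to `i` nor below it belongs to a non-neighbour of `i`.
      split i k (no k≢mi)  (no ¬mk⋖i) = cong (ℤ._* y (m k)) (nonedge⇒adj≡0 G i k λ ik → ¬mk⋖i
        ( (λ mk≡i → k≢mi (trans (sym (m-involutive k)) (cong m mk≡i)))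
        , trans (cong (λ j → edge G j i) (m-involutive k)) (trans (edgeSym G k i) ik)))

      sum-diag : ∀ i → ℤΣ.sum (λ k → diag i k (k ≟ m i)) ≡ adj G i (m i) ℤ.* y i
      sum-diag i = trans (ℤ-sum-single _ (m i) (λ k k≢mi → off k k≢mi (k ≟ m i))) (on (m i ≟ m i))
        where
        off : ∀ k → k ≢ m i → (k≟mi : Dec (k ≡ m i)) → diag i k k≟mi ≡ ℤ.+ 0
        off k k≢mi (yes k≡mi) = contradiction k≡mi k≢mi
        off k k≢mi (no _)     = refl
        on : (mi≟mi : Dec (m i ≡ m i)) → diag i (m i) mi≟mi ≡ adj G i (m i) ℤ.* y i
        on (yes _)    = refl
        on (no mi≢mi) = contradiction refl mi≢mi

      solves : ∀ i → ℤΣ.sum (λ k → adj G i k ℤ.* solution k) ≡ b i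
      solves i = begin
        ℤΣ.sum (λ k → adj G i k ℤ.* solution k)                    ≡⟨ ℤΣ.sum-cong-≗ (λ k → split i k (k ≟ m i) (m k ⋖? i)) ⟩
        ℤΣ.sum (λ k → diag i k (k ≟ m i) ℤ.+ rest i k)             ≡⟨ ℤΣ.∑-distrib-+ (λ k → diag i k (k ≟ m i)) (rest i) ⟩
        ℤΣ.sum (λ k → diag i k (k ≟ m i)) ℤ.+ r                    ≡⟨ cong (ℤ._+ r) (sum-diag i) ⟩
        a ℤ.* y i ℤ.+ r                                            ≡⟨ cong (λ w → a ℤ.* w ℤ.+ r) (Fix.unfold-wfRec {i}) ⟩
        a ℤ.* (a ℤ.* (b i ℤ.- r)) ℤ.+ r                            ≡⟨ cong (ℤ._+ r) (sym (ℤₚ.*-assoc a a (b i ℤ.- r))) ⟩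
        a ℤ.* a ℤ.* (b i ℤ.- r) ℤ.+ r                              ≡⟨ cong (λ c → c ℤ.* (b i ℤ.- r) ℤ.+ r) (adj-square G i (m i) (m-edge i)) ⟩
        ℤ.+ 1 ℤ.* (b i ℤ.- r) ℤ.+ r                                ≡⟨ 1*[b-r]+r≡b (b i) r ⟩
        b i                                                        ∎
        where
        open ≡-Reasoning
        a = adj G i (m i)
        r = ℤΣ.sum (rest i)

    δ : Fin n → Fin n → ℤ
    δ j i = if ⌊ i ≟ j ⌋ then ℤ.+ 1 else ℤ.+ 0

    fromℤ-δ : ∀ i j → fromℤ (δ j i) ≡ Iℚ i j
    fromℤ-δ i j with i ≟ j
    ... | yes _ = refl
    ... | no _  = refl

    B : Matℚ n
    B i j = fromℤ (Solve.solution (δ j) i)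

    AB≡I : RightInverse (adjℚ G) B
    AB≡I i j = trans (fromℤ-sum-* (adj G i) (Solve.solution (δ j)))
                 (trans (cong fromℤ (Solve.solves (δ j) i)) (fromℤ-δ i j))

    -- The transpose of `AB≡I`, as both matrices are symmetric.
    BA≡I : ∀ i j → (B · adjℚ G) i j ≡ Iℚ i j
    BA≡I i j = begin
      ℚΣ.sum (λ k → B i k * adjℚ G k j)    ≡⟨ ℚΣ.sum-cong-≗ transposed ⟩
      (adjℚ G · B) j i                     ≡⟨ AB≡I j i ⟩
      Iℚ j i                               ≡⟨ Iℚ-sym ⟩
      Iℚ i j                               ∎
      where
      open ≡-Reasoning
      transposed : ∀ k → B i k * adjℚ G k j ≡ adjℚ G j k * B k i
      transposed k = trans (ℚₚ.*-comm (B i k) (adjℚ G k j))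
        (cong₂ _*_ (cong fromℤ (adj-sym G k j)) (inverse-symmetric G S S-unique AB≡I i k))
      Iℚ-sym : Iℚ j i ≡ Iℚ i j
      Iℚ-sym with i ≟ j
      ... | yes refl = Iℚ-diag i
      ... | no i≢j   = Iℚ-off (i≢j ∘ sym)

  perfectMatching⇒integralInverse : HasIntegralInverse G
  perfectMatching⇒integralInverse =
    B , ((λ i j → trans (*ℚ≡· (adjℚ G) B i j) (AB≡I i j)) , (λ i j → trans (*ℚ≡· B (adjℚ G) i j) (BA≡I i j))) ,
    λ i j → Solve.solution (δ j) i , refl

theorem3p3 : ∀ {n} (G : SignedGraph n) (S : Subgraph n) → UniqueSachs G S →
    (HasIntegralInverse G ⇔ IsPerfectMatching S) × (HasSimpleInverse G → IsPerfectMatching S)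
theorem3p3 G S S-unique =
  mk⇔ (integralInverse⇒perfectMatching G S S-unique) (perfectMatching⇒integralInverse G S S-unique) ,
  simpleInverse⇒perfectMatching G S S-unique
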